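{- Let $L$ be a loop of order $n$ with underlying set $I_n=\{1,2,\ldots,n\}$, whose product of $x$ and $y$ is written $xy$, and let $c$ be any non-identity element of $L$. Let $\Gamma_3$ be the digraph with vertex set $I_n\times I_n\times\mathbb{Z}_2$ whose darts (arcs) are exactly the following: \begin{itemize} \item $(x,y,i)\mapsto(z,y,i)$ for all $i\in\mathbb{Z}_2$, $x,y,z\in I_n$, $x\neq z$; \item $(x,y,i)\mapsto(x,z,i)$ for all $i\in\mathbb{Z}_2$, $x,y,z\in I_n$, $y\neq z$; \item $(x,y,0)\mapsto(xy,z,1)$ for all $x,y,z\in I_n$; \item $(x,y,1)\mapsto(z,yx,0)$ for all $x,y,z\in I_n$; \item $(x,y,0)\mapsto(c(xy),z,1)$ for all $x,y,z\in I_n$; \item $(x,y,1)\mapsto(z,(yx)c,0)$ for all $x,y,z\in I_n$. \end{itemize} Then $\Gamma_3$ is a directed strongly regular graph with parameter set $(2n^2,\,4n-2,\,2n+2,\,n+2,\,6)$.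
   Context: A quasigroup is a set $Q$ with a binary operation such that for all $a,b\in Q$ each of the equations $ax=b$ and $ya=b$ has a unique solution in $Q$. A loop is a quasigroup with an identity element $e$, i.e. $ex=xe=x$ for every $x$. Associativity is not assumed. A directed strongly regular graph (DSRG) with parameter set $(N,k,t,\lambda,\mu)$ (in this order) is a loopless directed graph on $N$ vertices that is regular of valency $k$ (every vertex has in-degree and out-degree $k$), such that every vertex is incident with exactly $t$ undirected edges (an undirected edge is a pair of opposite arcs), and for any two distinct vertices $x,y$ the number of directed paths of length 2 from $x$ to $y$ is $\lambda$ if there is an arc from $x$ to $y$ and $\mu$ otherwise. Equivalently, its adjacency matrix $A$ (with zero diagonal) satisfies $AJ=JA=kJ$ and $A^2=tI+\lambda A+\mu(J-I-A)$, where $J$ is the all-one matrix and $I$ the identity matrix. The case $t=k$ (an undirected strongly regular graph) is allowed in this definition. -}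

module Defs where

open import Algebra.Core using (Op₂)
open import Data.Fin.Base using (Fin)
open import Data.Fin.Patterns using (0F; 1F)
open import Data.List.Base using (List; length)
open import Data.List.Membership.Propositional using (_∈_)
open import Data.List.Relation.Unary.Unique.Propositional using (Unique)
open import Data.Nat.Base using (ℕ)
open import Data.Product.Base using (_×_; _,_; ∃-syntax)
open import Data.Unit.Base using (⊤)
open import Function.Bundles using (_⇔_)
open import Relation.Binary.PropositionalEquality.Core using (_≡_; _≢_)
open import Relation.Nullary.Negation.Core using (¬_)

-- Counts the elements satisfying P, not the proofs of P: a duplicate-free list
-- enumerates them, so P need be neither proof-irrelevant nor given with a
-- decision procedure.
HasCardinality : {A : Set} → (A → Set) → ℕ → Set
HasCardinality {A} P m =
  ∃[ xs ] Unique xs × (∀ (a : A) → a ∈ xs ⇔ P a) × length xs ≡ m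

-- Only the inhabitedness of x ⟶ y matters, so there are no multiple arcs.
record Digraph : Set₁ where
  field
    Vertex : Set
    _⟶_    : Vertex → Vertex → Set

record IsDSRG (G : Digraph) (N k t lam mu : ℕ) : Set where
  open Digraph G
  field
    order      : HasCardinality {Vertex} (λ _ → ⊤) N
    loopless   : ∀ x → ¬ (x ⟶ x)
    outDegree  : ∀ x → HasCardinality (λ y → x ⟶ y) k
    inDegree   : ∀ x → HasCardinality (λ y → y ⟶ x) k
    undirected : ∀ x → HasCardinality (λ y → (x ⟶ y) × (y ⟶ x)) t
    -- A directed path of length 2 is determined by its middle vertex z.
    adjacent    : ∀ x y → x ≢ y → x ⟶ y →
                  HasCardinality (λ z → (x ⟶ z) × (z ⟶ y)) lam
    nonadjacent : ∀ x y → x ≢ y → ¬ (x ⟶ y) →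
                  HasCardinality (λ z → (x ⟶ z) × (z ⟶ y)) mu

-- Fin n stands for {1,…,n} and Fin 2 for ℤ₂.
module _ {n : ℕ} (_∙_ : Op₂ (Fin n)) (c : Fin n) where

  data Γ₃-Arc : Fin n × Fin n × Fin 2 → Fin n × Fin n × Fin 2 → Set where
    arc₁ : ∀ i x y z → x ≢ z → Γ₃-Arc (x , y , i) (z , y , i)
    arc₂ : ∀ i x y z → y ≢ z → Γ₃-Arc (x , y , i) (x , z , i)
    arc₃ : ∀ x y z → Γ₃-Arc (x , y , 0F) (x ∙ y , z , 1F)
    arc₄ : ∀ x y z → Γ₃-Arc (x , y , 1F) (z , y ∙ x , 0F)
    arc₅ : ∀ x y z → Γ₃-Arc (x , y , 0F) (c ∙ (x ∙ y) , z , 1F)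
    arc₆ : ∀ x y z → Γ₃-Arc (x , y , 1F) (z , (y ∙ x) ∙ c , 0F)

  Γ₃ : Digraph
  Γ₃ = record
    { Vertex = Fin n × Fin n × Fin 2
    ; _⟶_    = Γ₃-Arc
    }

{-# OPTIONS --safe #-}

-- Only two features of the maps w ↦ cw and w ↦ wc matter: they are permutations
-- without fixed points.  Replacing them by arbitrary such f and g makes the
-- definition symmetric: (x , y , i) ↦ (y , x , 1 - i) exchanges f and g, so it
-- suffices to count around a vertex (x , y , 0).  Inside a layer the graph is the
-- rook's graph.  Between the layers every count splits into the two cases given by
-- w ≡ s and w ≡ f s, and in each of them quasigroup division determines the vertex
-- from one of its coordinates.
module Submission where

open import Algebra.Core using (Op₂)
open import Algebra.Structures using (IsLoop; IsQuasigroup)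
open import Data.Empty using (⊥-elim)
open import Data.Fin.Base using (Fin; opposite; punchIn; punchOut)
open import Data.Fin.Patterns using (0F; 1F)
open import Data.Fin.Properties
  using (*↔×; opposite-involutive; punchIn-injective; punchInᵢ≢i;
         punchIn-punchOut; punchOut-cong; punchOut-punchIn)
open import Data.List.Base using ([]; _∷_; map; _++_; length; allFin)
open import Data.List.Membership.Propositional using (_∈_)
open import Data.List.Membership.Propositional.Properties
  using (∈-map⁺; ∈-map⁻; ∈-++⁺ˡ; ∈-++⁺ʳ; ∈-++⁻; ∈-allFin)
open import Data.List.Properties using (length-map; length-++; length-tabulate)
open import Data.List.Relation.Unary.All using ([])
open import Data.List.Relation.Unary.AllPairs using ([]; _∷_)
open import Data.List.Relation.Unary.Any using (here)
open import Data.List.Relation.Unary.Unique.Propositional.Properties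
  using (map⁺; ++⁺; allFin⁺)
open import Data.Nat.Base using (ℕ; suc; _+_; _*_; _∸_; _^_)
open import Data.Nat.Tactic.RingSolver using (solve-∀)
open import Data.Product.Base using (_×_; _,_; proj₁; proj₂; ∃-syntax)
open import Data.Product.Algebra using (×-comm)
open import Data.Sum.Base using (_⊎_; inj₁; inj₂; [_,_]′)
open import Data.Unit.Base using (⊤; tt)
open import Function.Base using (id; _∘_)
open import Function.Bundles using (_⇔_; mk⇔; Equivalence; _↔_; mk↔ₛ′; Inverse)
open import Function.Construct.Identity using (↔-id)
open import Function.Construct.Symmetry using (↔-sym)
open import Relation.Binary.PropositionalEquality
  using (_≡_; _≢_; refl; sym; trans; cong; subst; ≢-sym)
open import Relation.Nullary.Negation.Core using (¬_; contradiction)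
open import Defs

open Inverse using (to; from; strictlyInverseˡ; strictlyInverseʳ)

private variable
  A B V W : Set
  P Q : A → Set
  m n : ℕ

-- Cardinalities

card-⇔ : (∀ a → P a → Q a) → (∀ a → Q a → P a) →
         HasCardinality P m → HasCardinality Q m
card-⇔ P⇒Q Q⇒P (xs , uniq , mem , len) =
  xs , uniq ,
  (λ a → mk⇔ (P⇒Q a ∘ Equivalence.to (mem a)) (Equivalence.from (mem a) ∘ Q⇒P a)) ,
  len

card-≡ : m ≡ n → HasCardinality P m → HasCardinality P n
card-≡ refl c = c

card-∅ : (∀ a → ¬ P a) → HasCardinality P 0
card-∅ ¬P = [] , [] , (λ a → mk⇔ (λ ()) (⊥-elim ∘ ¬P a)) , refl

card-singleton : ∀ b → P b → (∀ a → P a → a ≡ b) → HasCardinality P 1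
card-singleton b Pb unique =
  b ∷ [] , [] ∷ [] ,
  (λ a → mk⇔ (λ { (here refl) → Pb }) (here ∘ unique a)) , refl

card-⊎ : (∀ a → P a → ¬ Q a) → HasCardinality P m → HasCardinality Q n →
         HasCardinality (λ a → P a ⊎ Q a) (m + n)
card-⊎ disjoint (xs , uxs , mxs , refl) (ys , uys , mys , refl) =
  xs ++ ys ,
  ++⁺ uxs uys (λ {a} (a∈xs , a∈ys) →
    disjoint a (Equivalence.to (mxs a) a∈xs) (Equivalence.to (mys a) a∈ys)) ,
  (λ a → mk⇔
    ([ inj₁ ∘ Equivalence.to (mxs a) , inj₂ ∘ Equivalence.to (mys a) ]′ ∘ ∈-++⁻ xs)
    [ ∈-++⁺ˡ ∘ Equivalence.from (mxs a) , ∈-++⁺ʳ xs ∘ Equivalence.from (mys a) ]′) ,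
  length-++ xs

card-image : (f : A → B) → (∀ {a a′} → f a ≡ f a′ → a ≡ a′) →
             (∀ a → P a → Q (f a)) → (∀ b → Q b → ∃[ a ] P a × b ≡ f a) →
             HasCardinality P m → HasCardinality Q m
card-image {Q = Q} f f-inj P⇒Q Q⇒P (xs , uniq , mem , len) =
  map f xs , map⁺ f-inj uniq , (λ b → mk⇔ (sound b) (complete b)) ,
  trans (length-map f xs) len
  where
  sound : ∀ b → b ∈ map f xs → Q b
  sound b b∈ with ∈-map⁻ f b∈
  ... | a , a∈xs , refl = P⇒Q a (Equivalence.to (mem a) a∈xs)
  complete : ∀ b → Q b → b ∈ map f xs
  complete b Qb with Q⇒P b Qb
  ... | a , Pa , refl = ∈-map⁺ f (Equivalence.from (mem a) Pa)

from-injective : (φ : A ↔ B) → ∀ {b b′} → from φ b ≡ from φ b′ → b ≡ b′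
from-injective φ {b} {b′} eq =
  trans (sym (strictlyInverseˡ φ b)) (trans (cong (to φ) eq) (strictlyInverseˡ φ b′))

card-↔ : (φ : B ↔ A) → (∀ b → P (to φ b) ⇔ Q b) →
         HasCardinality P m → HasCardinality Q m
card-↔ {P = P} {Q = Q} φ P⇔Q = card-image (from φ) (from-injective φ)
  (λ a Pa → Equivalence.to (P⇔Q (from φ a))
              (subst P (sym (strictlyInverseˡ φ a)) Pa))
  (λ b Qb → to φ b , Equivalence.from (P⇔Q b) Qb , sym (strictlyInverseʳ φ b))

card-Fin : ∀ n → HasCardinality {Fin n} (λ _ → ⊤) n
card-Fin n =
  allFin n , allFin⁺ n , (λ a → mk⇔ _ (λ _ → ∈-allFin a)) , length-tabulate id

-- `punchIn x` enumerates exactly the elements other than `x`.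
card-≢ : (x : Fin (suc n)) → HasCardinality (λ u → x ≢ u) n
card-≢ {n} x = card-image {P = λ _ → ⊤} (punchIn x) (punchIn-injective x _ _)
  (λ a _ → ≢-sym (punchInᵢ≢i x a))
  (λ b x≢b → punchOut x≢b , tt , sym (punchIn-punchOut x≢b))
  (card-Fin n)

-- After `x` is deleted, `y` becomes `punchOut x≢y`, and `card-≢` deletes it in turn.
card-≢-≢ : {x y : Fin (suc (suc n))} → x ≢ y →
           HasCardinality (λ u → x ≢ u × y ≢ u) n
card-≢-≢ {n} {x} {y} x≢y =
  card-image {P = λ a → punchOut x≢y ≢ a} (punchIn x) (punchIn-injective x _ _)
    (λ a ≢a → ≢-sym (punchInᵢ≢i x a) ,
              λ { refl → ≢a (trans (punchOut-cong x refl) (punchOut-punchIn x)) })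
    (λ b (x≢b , y≢b) → punchOut x≢b ,
      (λ eq → y≢b (trans (sym (punchIn-punchOut x≢y))
                (trans (cong (punchIn x) eq) (punchIn-punchOut x≢b)))) ,
      sym (punchIn-punchOut x≢b))
    (card-≢ (punchOut x≢y))

card-graph : (h : A → B) → HasCardinality P m →
             HasCardinality (λ ((a , b) : A × B) → P a × b ≡ h a) m
card-graph h = card-image (λ a → a , h a) (cong proj₁)
  (λ a Pa → Pa , refl) (λ { (a , _) (Pa , refl) → a , Pa , refl })

card-transposed-graph : (h : B → A) → HasCardinality P m →
                        HasCardinality (λ ((a , b) : A × B) → a ≡ h b × P b) m
card-transposed-graph h = card-image (λ b → h b , b) (cong proj₂)
  (λ b Pb → refl , Pb) (λ { (_ , b) (refl , Pb) → b , Pb , refl })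

-- Recording the layer as an equation beside `P` makes the two parts disjoint. All later counts are
-- thereby reduced to pairs.
card-layers : {P : A × B × Fin 2 → Set} →
              HasCardinality (λ ((a , b) : A × B) → P (a , b , 0F)) m →
              HasCardinality (λ ((a , b) : A × B) → P (a , b , 1F)) n →
              HasCardinality P (m + n)
card-layers {A = A} {B = B} {P = P} c₀ c₁ =
  card-⇔ (λ { (_ , _ , 0F) (inj₁ (p , _)) → p
            ; (_ , _ , 1F) (inj₂ (p , _)) → p
            ; (_ , _ , 0F) (inj₂ (_ , ()))
            ; (_ , _ , 1F) (inj₁ (_ , ())) })
         (λ { (_ , _ , 0F) p → inj₁ (p , refl)
            ; (_ , _ , 1F) p → inj₂ (p , refl) })
         (card-⊎ (λ { _ (_ , refl) (_ , ()) }) (layer 0F c₀) (layer 1F c₁))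
  where
  layer : ∀ i {m} → HasCardinality (λ ((a , b) : A × B) → P (a , b , i)) m →
          HasCardinality (λ v → P v × proj₂ (proj₂ v) ≡ i) m
  layer i = card-image (λ (a , b) → a , b , i) (λ { refl → refl })
    (λ _ p → p , refl) (λ { (a , b , _) (p , refl) → (a , b) , p , refl })

-- Permutations without fixed points

-- Merges the two families of arcs that leave a layer, the plain product and its translate.
Near : (A → A) → A → A → Set
Near f s t = t ≡ s ⊎ t ≡ f s

module _ (f : A ↔ A) (f-free : ∀ a → to f a ≢ a) {R : B → Set} {h : B → A} where

  card-near-target : ∀ {s} →
    HasCardinality (λ b → h b ≡ s × R b) m →
    HasCardinality (λ b → h b ≡ to f s × R b) n →
    HasCardinality (λ b → Near (to f) s (h b) × R b) (m + n)
  card-near-target {s = s} c d = card-⇔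
    (λ _ → [ (λ (p , r) → inj₁ p , r) , (λ (p , r) → inj₂ p , r) ]′)
    (λ _ → λ { (inj₁ p , r) → inj₁ (p , r) ; (inj₂ p , r) → inj₂ (p , r) })
    (card-⊎ (λ _ (p , _) (q , _) → f-free s (trans (sym q) p)) c d)

  -- Seen from `t`, the source is `t` itself or its preimage under `f`. These differ, since
  -- otherwise `t` would be a fixed point.
  card-near-source : ∀ {t} →
    HasCardinality (λ b → h b ≡ t × R b) m →
    HasCardinality (λ b → h b ≡ from f t × R b) n →
    HasCardinality (λ b → Near (to f) (h b) t × R b) (m + n)
  card-near-source {t = t} c d = card-⇔
    (λ _ → λ { (inj₁ (p , r)) → inj₁ (sym p) , r
             ; (inj₂ (p , r)) → inj₂ (sym (trans (cong (to f) p) (strictlyInverseˡ f t))) , r })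
    (λ _ → λ { (inj₁ p , r) → inj₁ (sym p , r)
             ; (inj₂ p , r) → inj₂ (sym (trans (cong (from f) p) (strictlyInverseʳ f _)) , r) })
    (card-⊎ (λ _ (p , _) (q , _) →
        f-free t (trans (cong (to f) (trans (sym p) q)) (strictlyInverseˡ f t)))
      c d)

-- The conditions of a directed strongly regular graph at one vertex

record IsDSRGAt {V : Set} (R : V → V → Set) (k t lam mu : ℕ) (x : V) : Set where
  field
    loopless    : ¬ R x x
    outDegree   : HasCardinality (λ y → R x y) k
    inDegree    : HasCardinality (λ y → R y x) k
    undirected  : HasCardinality (λ y → R x y × R y x) t
    adjacent    : ∀ y → x ≢ y → R x y → HasCardinality (λ z → R x z × R z y) lam
    nonadjacent : ∀ y → x ≢ y → ¬ R x y → HasCardinality (λ z → R x z × R z y) mu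

-- The conditions mention only arcs and equality of vertices, so they survive an isomorphism. This
-- serves both the passage to `Γ₃-Arc` and the exchange of the layers.
isDSRGAt-↔ : {R : V → V → Set} {S : W → W → Set} (φ : W ↔ V) →
             (∀ a b → R (to φ a) (to φ b) ⇔ S a b) →
             ∀ {k t lam mu x} → IsDSRGAt R k t lam mu (to φ x) → IsDSRGAt S k t lam mu x
isDSRGAt-↔ {R = R} {S = S} φ R⇔S {x = x} local = record
  { loopless    = loopless ∘ Equivalence.from (R⇔S x x)
  ; outDegree   = card-↔ φ (λ y → R⇔S x y) outDegree
  ; inDegree    = card-↔ φ (λ y → R⇔S y x) inDegree
  ; undirected  = card-↔ φ (λ y → both x y y x) undirected
  ; adjacent    = λ y x≢y xy → card-↔ φ (λ z → both x z z y)
                    (adjacent (to φ y) (x≢y ∘ from-injective (↔-sym φ)) (Equivalence.from (R⇔S x y) xy))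
  ; nonadjacent = λ y x≢y ¬xy → card-↔ φ (λ z → both x z z y)
                    (nonadjacent (to φ y) (x≢y ∘ from-injective (↔-sym φ)) (¬xy ∘ Equivalence.to (R⇔S x y)))
  }
  where
  open IsDSRGAt local
  both : ∀ a b c d →
         (R (to φ a) (to φ b) × R (to φ c) (to φ d)) ⇔ (S a b × S c d)
  both a b c d = mk⇔
    (λ (p , q) → Equivalence.to (R⇔S a b) p , Equivalence.to (R⇔S c d) q)
    (λ (p , q) → Equivalence.from (R⇔S a b) p , Equivalence.from (R⇔S c d) q)

-- The rook's graph

-- Each disjunct is the graph of a constant function, in the form that `card-graph` and
-- `card-transposed-graph` count.
Rook : A × B → A × B → Set
Rook (x , y) (u , v) = (x ≢ u × v ≡ y) ⊎ (u ≡ x × y ≢ v)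

rook-sym : (p q : A × B) → Rook p q → Rook q p
rook-sym _ _ (inj₁ (x≢u , v≡y)) = inj₁ (≢-sym x≢u , sym v≡y)
rook-sym _ _ (inj₂ (u≡x , y≢v)) = inj₂ (sym u≡x , ≢-sym y≢v)

rook-irrefl : (p : A × B) → ¬ Rook p p
rook-irrefl _ (inj₁ (x≢x , _)) = x≢x refl
rook-irrefl _ (inj₂ (_ , y≢y)) = y≢y refl

rook-swap : ∀ {x u : A} {y v : B} → Rook (x , y) (u , v) → Rook (y , x) (v , u)
rook-swap (inj₁ (x≢u , v≡y)) = inj₂ (v≡y , x≢u)
rook-swap (inj₂ (u≡x , y≢v)) = inj₁ (y≢v , u≡x)

rook-degree : (x y : Fin (suc n)) → HasCardinality (Rook (x , y)) (n + n)
rook-degree x y = card-⊎ (λ _ (x≢u , _) (u≡x , _) → x≢u (sym u≡x))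
  (card-graph (λ _ → y) (card-≢ x)) (card-transposed-graph (λ _ → x) (card-≢ y))

CommonRook : A × B → A × B → A × B → Set
CommonRook p q r = Rook p r × Rook r q

-- A common neighbour outside the row would share its column with both squares, so only the
-- remaining squares of the row qualify.
rook-common-row : ∀ {x x′ : Fin (suc (suc n))} (y : A) → x ≢ x′ →
                  HasCardinality (CommonRook (x , y) (x′ , y)) n
rook-common-row y x≢x′ = card-⇔
  (λ _ → λ { ((x≢u , x′≢u) , refl) → inj₁ (x≢u , refl) , inj₁ (≢-sym x′≢u , refl) })
  (λ _ → λ { (inj₁ (x≢u , refl) , inj₁ (u≢x′ , _)) → (x≢u , ≢-sym u≢x′) , refl
           ; (inj₁ (_ , refl) , inj₂ (_ , v≢v)) → contradiction refl v≢v
           ; (inj₂ (_ , y≢v) , inj₁ (_ , refl)) → contradiction refl y≢v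
           ; (inj₂ (refl , _) , inj₂ (refl , _)) → contradiction refl x≢x′ })
  (card-graph (λ _ → y) (card-≢-≢ x≢x′))

rook-common-column : ∀ (x : A) {y y′ : Fin (suc (suc n))} → y ≢ y′ →
                     HasCardinality (CommonRook (x , y) (x , y′)) n
rook-common-column x y≢y′ = card-↔ (×-comm _ _)
  (λ _ → mk⇔ (λ (p , q) → rook-swap p , rook-swap q) (λ (p , q) → rook-swap p , rook-swap q))
  (rook-common-row x y≢y′)

rook-common-adjacent : (p q : Fin (suc (suc n)) × Fin (suc (suc n))) → Rook p q →
                       HasCardinality (CommonRook p q) n
rook-common-adjacent (x , y) (x′ , y′) (inj₁ (x≢x′ , refl)) = rook-common-row y x≢x′
rook-common-adjacent (x , y) (x′ , y′) (inj₂ (refl , y≢y′)) = rook-common-column x y≢y′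

-- The common neighbours are the other two corners of the rectangle spanned by the squares.
rook-common-nonadjacent : {x x′ : A} {y y′ : B} → x ≢ x′ → y ≢ y′ →
                          HasCardinality (CommonRook (x , y) (x′ , y′)) 2
rook-common-nonadjacent {x = x} {x′} {y} {y′} x≢x′ y≢y′ = card-⇔
  (λ _ → λ { (inj₁ refl) → inj₁ (x≢x′ , refl) , inj₂ (refl , y≢y′)
           ; (inj₂ refl) → inj₂ (refl , y≢y′) , inj₁ (x≢x′ , refl) })
  (λ _ → λ { (inj₁ (x≢u , refl) , inj₁ (_ , refl)) → contradiction refl y≢y′
           ; (inj₁ (_ , refl) , inj₂ (refl , _)) → inj₁ refl
           ; (inj₂ (refl , _) , inj₁ (_ , refl)) → inj₂ refl
           ; (inj₂ (refl , _) , inj₂ (refl , _)) → contradiction refl x≢x′ })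
  (card-⊎ (λ { _ refl refl → x≢x′ refl })
    (card-singleton (x′ , y) refl (λ _ → id))
    (card-singleton (x , y′) refl (λ _ → id)))

-- The generalised graph and its symmetry

module _ {n : ℕ} (_∙_ : Op₂ (Fin n)) where

  -- Cases on the layers let the arc relation compute inside `card-layers`. The maps `f` and `g`
  -- stand for left and right multiplication by `c`.
  Arc : (f g : Fin n → Fin n) → Fin n × Fin n × Fin 2 → Fin n × Fin n × Fin 2 → Set
  Arc f g (x , y , 0F) (u , v , 0F) = Rook (x , y) (u , v)
  Arc f g (x , y , 1F) (u , v , 1F) = Rook (x , y) (u , v)
  Arc f g (x , y , 0F) (u , v , 1F) = Near f (x ∙ y) u
  Arc f g (x , y , 1F) (u , v , 0F) = Near g (y ∙ x) v

  exchange : (Fin n × Fin n × Fin 2) ↔ (Fin n × Fin n × Fin 2)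
  exchange = mk↔ₛ′ σ σ σ-involutive σ-involutive
    where
    σ : Fin n × Fin n × Fin 2 → Fin n × Fin n × Fin 2
    σ (x , y , i) = y , x , opposite i
    σ-involutive : ∀ v → σ (σ v) ≡ v
    σ-involutive (x , y , i) = cong (λ j → x , y , j) (opposite-involutive i)

  -- Layer 1 multiplies its coordinates in the opposite order, so after the swap the crossing arcs
  -- agree definitionally.
  arc-exchange : ∀ {f g} a b → Arc g f (to exchange a) (to exchange b) ⇔ Arc f g a b
  arc-exchange (_ , _ , 0F) (_ , _ , 0F) = mk⇔ rook-swap rook-swap
  arc-exchange (_ , _ , 0F) (_ , _ , 1F) = mk⇔ id id
  arc-exchange (_ , _ , 1F) (_ , _ , 0F) = mk⇔ id id
  arc-exchange (_ , _ , 1F) (_ , _ , 1F) = mk⇔ rook-swap rook-swap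

  Γ₃-arc : ∀ {c} a b → Arc (c ∙_) (_∙ c) a b ⇔ Γ₃-Arc _∙_ c a b
  Γ₃-arc {c} a b = mk⇔ (construct a b) destruct
    where
    construct : ∀ a b → Arc (c ∙_) (_∙ c) a b → Γ₃-Arc _∙_ c a b
    construct (_ , _ , 0F) (_ , _ , 0F) (inj₁ (p , refl)) = arc₁ _ _ _ _ p
    construct (_ , _ , 0F) (_ , _ , 0F) (inj₂ (refl , p)) = arc₂ _ _ _ _ p
    construct (_ , _ , 1F) (_ , _ , 1F) (inj₁ (p , refl)) = arc₁ _ _ _ _ p
    construct (_ , _ , 1F) (_ , _ , 1F) (inj₂ (refl , p)) = arc₂ _ _ _ _ p
    construct (_ , _ , 0F) (_ , _ , 1F) (inj₁ refl) = arc₃ _ _ _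
    construct (_ , _ , 0F) (_ , _ , 1F) (inj₂ refl) = arc₅ _ _ _
    construct (_ , _ , 1F) (_ , _ , 0F) (inj₁ refl) = arc₄ _ _ _
    construct (_ , _ , 1F) (_ , _ , 0F) (inj₂ refl) = arc₆ _ _ _
    destruct : ∀ {a b} → Γ₃-Arc _∙_ c a b → Arc (c ∙_) (_∙ c) a b
    destruct (arc₁ 0F _ _ _ p) = inj₁ (p , refl)
    destruct (arc₁ 1F _ _ _ p) = inj₁ (p , refl)
    destruct (arc₂ 0F _ _ _ p) = inj₂ (refl , p)
    destruct (arc₂ 1F _ _ _ p) = inj₂ (refl , p)
    destruct (arc₃ _ _ _) = inj₁ refl
    destruct (arc₄ _ _ _) = inj₁ refl
    destruct (arc₅ _ _ _) = inj₂ refl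
    destruct (arc₆ _ _ _) = inj₂ refl

-- Counting with quasigroup division

module _ {k : ℕ} {_∙_ _\\_ _//_ : Op₂ (Fin (2 + k))}
         (isQuasigroup : IsQuasigroup _≡_ _∙_ _\\_ _//_) where

  open IsQuasigroup isQuasigroup
    using (leftDividesˡ; leftDividesʳ; rightDividesˡ; rightDividesʳ)

  private
    N : ℕ
    N = 2 + k

    Point : Set
    Point = Fin N × Fin N

  ∙≡⇒≡// : ∀ {u v t} → u ∙ v ≡ t → u ≡ t // v
  ∙≡⇒≡// {u} {v} eq = trans (sym (rightDividesʳ v u)) (cong (_// v) eq)

  ∙≡⇒≡\\ : ∀ {u v t} → u ∙ v ≡ t → v ≡ u \\ t
  ∙≡⇒≡\\ {u} {v} eq = trans (sym (leftDividesʳ u v)) (cong (u \\_) eq)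

  -- The coordinate `u` is free and division yields `v`. The factor `⊤` fills the place of `R` in
  -- `card-near-source`.
  card-product≡ : ∀ t → HasCardinality (λ ((u , v) : Point) → v ∙ u ≡ t × ⊤) N
  card-product≡ t = card-⇔
    (λ { (u , _) (_ , refl) → rightDividesˡ u t , tt })
    (λ _ (eq , _) → tt , ∙≡⇒≡// eq)
    (card-graph (t //_) (card-Fin N))

  card-column≡ : ∀ w → HasCardinality (λ ((u , v) : Point) → u ≡ w × ⊤) N
  card-column≡ w = card-transposed-graph (λ _ → w) (card-Fin N)

  card-column-product≡ : ∀ s t →
    HasCardinality (λ ((w , z) : Point) → z ∙ w ≡ t × w ≡ s) 1
  card-column-product≡ s t = card-singleton (s , t // s)
    (rightDividesˡ s t , refl) (λ { (w , z) (eq , refl) → cong (w ,_) (∙≡⇒≡// eq) })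

  -- A product value occurs once in each row and column, so every rook move from `(x , y)` changes
  -- the product.
  card-product-rook-none : ∀ {x y t} → x ∙ y ≡ t →
    HasCardinality (λ ((u , v) : Point) → u ∙ v ≡ t × Rook (x , y) (u , v)) 0
  card-product-rook-none {x} {y} eq = card-∅ λ
    { _ (uv≡t , inj₁ (x≢u , refl)) → x≢u (trans (∙≡⇒≡// eq) (sym (∙≡⇒≡// uv≡t)))
    ; _ (uv≡t , inj₂ (refl , y≢v)) → y≢v (trans (∙≡⇒≡\\ eq) (sym (∙≡⇒≡\\ uv≡t))) }

  -- The value `t` occurs once with second coordinate `y` and once with first coordinate `x`. Both
  -- places differ from `(x , y)` and from each other because `x ∙ y` is not `t`.
  card-product-rook : ∀ {x y t} → x ∙ y ≢ t →
    HasCardinality (λ ((u , v) : Point) → u ∙ v ≡ t × Rook (x , y) (u , v)) 2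
  card-product-rook {x} {y} {t} xy≢t = card-⇔
    (λ _ → λ { (inj₁ refl) → rightDividesˡ y t ,
                 inj₁ ((λ x≡ → xy≢t (trans (cong (_∙ y) x≡) (rightDividesˡ y t))) , refl)
             ; (inj₂ refl) → leftDividesˡ x t ,
                 inj₂ (refl , λ y≡ → xy≢t (trans (cong (x ∙_) y≡) (leftDividesˡ x t))) })
    (λ _ → λ { (uv≡t , inj₁ (_ , refl)) → inj₁ (cong (_, y) (∙≡⇒≡// uv≡t))
             ; (uv≡t , inj₂ (refl , _)) → inj₂ (cong (x ,_) (∙≡⇒≡\\ uv≡t)) })
    (card-⊎ (λ _ p q → xy≢t (trans (cong (x ∙_) (cong proj₂ (trans (sym p) q)))
                               (leftDividesˡ x t)))
      (card-singleton (t // y , y) refl (λ _ → id))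
      (card-singleton (x , x \\ t) refl (λ _ → id)))

  card-column-rook-own : ∀ x′ y′ →
    HasCardinality (λ (p : Point) → proj₁ p ≡ x′ × Rook p (x′ , y′)) (suc k)
  card-column-rook-own x′ y′ = card-⇔
    (λ { _ (refl , y′≢v) → refl , inj₂ (refl , ≢-sym y′≢v) })
    (λ { _ (u≡x′ , inj₁ (u≢x′ , _)) → contradiction u≡x′ u≢x′
       ; _ (u≡x′ , inj₂ (_ , v≢y′)) → u≡x′ , ≢-sym v≢y′ })
    (card-transposed-graph (λ _ → x′) (card-≢ y′))

  -- From another column, only the square in the row of `(x′ , y′)` reaches it by a rook move.
  card-column-rook : ∀ {w x′} y′ → w ≢ x′ →
    HasCardinality (λ (p : Point) → proj₁ p ≡ w × Rook p (x′ , y′)) 1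
  card-column-rook {w} y′ w≢x′ = card-singleton (w , y′)
    (refl , inj₁ (w≢x′ , refl))
    (λ { _ (refl , inj₁ (_ , refl)) → refl
       ; _ (refl , inj₂ (refl , _)) → contradiction refl w≢x′ })

  -- Walks around a vertex of layer 0

  module _ (f g : Fin N ↔ Fin N)
           (f-free : ∀ a → to f a ≢ a) (g-free : ∀ a → to g a ≢ a) where

    to≡⇒≡from : ∀ {a b} → a ≡ to f b → b ≡ from f a
    to≡⇒≡from {b = b} refl = sym (strictlyInverseʳ f b)

    ≡from⇒to≡ : ∀ {a b} → b ≡ from f a → a ≡ to f b
    ≡from⇒to≡ {a} refl = sym (strictlyInverseˡ f a)

    -- There is no condition on (x , y) and y′: this counts both the returning
    -- walks and the walks between two vertices of layer 0.
    card-through-other-layer : ∀ x y y′ →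
      HasCardinality
        (λ ((w , z) : Point) → Near (to f) (x ∙ y) w × Near (to g) (z ∙ w) y′) 4
    card-through-other-layer x y y′ =
      -- There are two choices of `w`, and for each two admissible values of `z ∙ w`; division then
      -- gives `z`.
      card-near-target f f-free (half (x ∙ y)) (half (to f (x ∙ y)))
      where
      half : ∀ s →
        HasCardinality (λ ((w , z) : Point) → w ≡ s × Near (to g) (z ∙ w) y′) 2
      half s = card-⇔ (λ _ (p , q) → q , p) (λ _ (q , p) → p , q)
        (card-near-source g g-free
          (card-column-product≡ s y′) (card-column-product≡ s (from g y′)))

    -- If the middle vertex is in layer 0, its product must be `u` or the preimage of `u`: the value
    -- already taken by `x ∙ y` gives 0 walks, the other 2. If it is in layer 1, it lies in column
    -- `x ∙ y` or its image under `f`: the column of the target gives `N` minus 1 walks, the other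
    -- 1.
    card-crossing-adjacent : ∀ x y u v → Near (to f) (x ∙ y) u →
      HasCardinality (λ z → Arc _∙_ (to f) (to g) (x , y , 0F) z ×
                            Arc _∙_ (to f) (to g) z (u , v , 1F)) (N + 2)
    card-crossing-adjacent x y u v (inj₁ refl) = card-≡ (arith k) (card-layers
      (card-⇔ (λ _ (p , q) → q , p) (λ _ (q , p) → p , q)
        (card-near-source f f-free
          (card-product-rook-none refl)
          (card-product-rook (f-free _ ∘ sym ∘ ≡from⇒to≡))))
      (card-near-target f f-free
        (card-column-rook-own u v)
        (card-column-rook v (f-free u))))
      where
      arith : ∀ k → 2 + (suc k + 1) ≡ 2 + k + 2
      arith = solve-∀
    card-crossing-adjacent x y u v (inj₂ refl) = card-≡ (arith k) (card-layers
      (card-⇔ (λ _ (p , q) → q , p) (λ _ (q , p) → p , q)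
        (card-near-source f f-free
          (card-product-rook (f-free _ ∘ sym))
          (card-product-rook-none (to≡⇒≡from refl))))
      (card-near-target f f-free
        (card-column-rook v (f-free _ ∘ sym))
        (card-column-rook-own u v)))
      where
      arith : ∀ k → 2 + 0 + (1 + suc k) ≡ 2 + k + 2
      arith = solve-∀

    -- Now neither product value is `x ∙ y` and neither column is that of the target, so the counts
    -- are 2 + 2 and 1 + 1.
    card-crossing-nonadjacent : ∀ x y u v → ¬ Near (to f) (x ∙ y) u →
      HasCardinality (λ z → Arc _∙_ (to f) (to g) (x , y , 0F) z ×
                            Arc _∙_ (to f) (to g) z (u , v , 1F)) 6
    card-crossing-nonadjacent x y u v ¬near = card-layers
      (card-⇔ (λ _ (p , q) → q , p) (λ _ (q , p) → p , q)
        (card-near-source f f-free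
          (card-product-rook (¬near ∘ inj₁ ∘ sym))
          (card-product-rook (¬near ∘ inj₂ ∘ ≡from⇒to≡))))
      (card-near-target f f-free
        (card-column-rook v (¬near ∘ inj₁ ∘ sym))
        (card-column-rook v (¬near ∘ inj₂ ∘ sym)))

    layer₀ : ∀ x y →
      IsDSRGAt (Arc _∙_ (to f) (to g)) (4 * N ∸ 2) (2 * N + 2) (N + 2) 6 (x , y , 0F)
    layer₀ x y = record
      { loopless    = rook-irrefl (x , y)
      ; outDegree   = card-≡ (arith-k k) (card-layers (rook-degree x y)
          (card-⇔ (λ _ → proj₁) (λ _ → _, tt)
            (card-near-target f f-free (card-column≡ _) (card-column≡ _))))
      ; inDegree    = card-≡ (arith-k k) (card-layers
          (card-⇔ (λ q → rook-sym (x , y) q) (λ q → rook-sym q (x , y)) (rook-degree x y))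
          (card-⇔ (λ _ → proj₁) (λ _ → _, tt)
            (card-near-source g g-free (card-product≡ _) (card-product≡ _))))
      -- All arcs inside the layer are undirected. The other undirected edges are closed walks
      -- through layer 1, four in number.
      ; undirected  = card-≡ (arith-t k) (card-layers
          (card-⇔ (λ q r → r , rook-sym (x , y) q r) (λ _ → proj₁) (rook-degree x y))
          (card-through-other-layer x y y))
      ; adjacent    = adjacent
      ; nonadjacent = nonadjacent
      }
      where
      -- With `N` in the form `2 + k`, the truncated subtraction in `4 * N ∸ 2` computes away and
      -- leaves this right-hand side.
      arith-k : ∀ k → (suc k + suc k) + ((2 + k) + (2 + k)) ≡ k + 3 * (2 + k)
      arith-k = solve-∀
      arith-t : ∀ k → suc k + suc k + 4 ≡ 2 * (2 + k) + 2
      arith-t = solve-∀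
      arith-λ : ∀ k → k + 4 ≡ 2 + k + 2
      arith-λ = solve-∀

      _⟶_ : Fin N × Fin N × Fin 2 → Fin N × Fin N × Fin 2 → Set
      _⟶_ = Arc _∙_ (to f) (to g)

      adjacent : ∀ b → (x , y , 0F) ≢ b → (x , y , 0F) ⟶ b →
        HasCardinality (λ z → ((x , y , 0F) ⟶ z) × (z ⟶ b)) (N + 2)
      adjacent (u , v , 0F) _ arc = card-≡ (arith-λ k) (card-layers
        (rook-common-adjacent (x , y) (u , v) arc) (card-through-other-layer x y v))
      adjacent (u , v , 1F) _ arc = card-crossing-adjacent x y u v arc

      nonadjacent : ∀ b → (x , y , 0F) ≢ b → ¬ ((x , y , 0F) ⟶ b) →
        HasCardinality (λ z → ((x , y , 0F) ⟶ z) × (z ⟶ b)) 6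
      -- Distinct nonadjacent squares differ in both coordinates, since agreement in one would force
      -- a rook move or equality. This gives 2 walks inside the layer and 4 outside it.
      nonadjacent (u , v , 0F) ≢b ¬arc = card-layers
        (rook-common-nonadjacent
          (λ { refl → ¬arc (inj₂ (refl , λ { refl → ≢b refl })) })
          (λ { refl → ¬arc (inj₁ ((λ { refl → ≢b refl }) , refl)) }))
        (card-through-other-layer x y v)
      nonadjacent (u , v , 1F) _ ¬arc = card-crossing-nonadjacent x y u v ¬arc

-- Order of the graph and the theorem for loops

card-vertices : ∀ n → HasCardinality {Fin n × Fin n × Fin 2} (λ _ → ⊤) (2 * n ^ 2)
card-vertices n = card-≡ (arith n) (card-layers (points n) (points n))
  where
  points : ∀ n → HasCardinality {Fin n × Fin n} (λ _ → ⊤) (n * n)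
  points n = card-↔ {P = λ _ → ⊤} (↔-sym (*↔× {n} {n})) (λ _ → mk⇔ _ _) (card-Fin (n * n))
  -- The factor `n * (n * 1)` is the unfolding of `n ^ 2`.
  arith : ∀ n → n * n + n * n ≡ 2 * (n * (n * 1))
  arith = solve-∀

theorem4p3 : (n : ℕ) (_∙_ _\\_ _//_ : Op₂ (Fin n)) (e : Fin n) →
    IsLoop _≡_ _∙_ _\\_ _//_ e →
    (c : Fin n) → c ≢ e →
    IsDSRG (Γ₃ _∙_ c) (2 * n ^ 2) (4 * n ∸ 2) (2 * n + 2) (n + 2) 6
-- A loop with a non-identity element has at least two elements: order 0 leaves no `e`, and order 1
-- forces `c` to be `e`.
theorem4p3 1 _ _ _ 0F _ 0F c≢e = contradiction refl c≢e
theorem4p3 (suc (suc k)) _∙_ _\\_ _//_ e isLoop c c≢e = record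
  { order       = card-vertices (2 + k)
  ; loopless    = λ x → IsDSRGAt.loopless (local x)
  ; outDegree   = λ x → IsDSRGAt.outDegree (local x)
  ; inDegree    = λ x → IsDSRGAt.inDegree (local x)
  ; undirected  = λ x → IsDSRGAt.undirected (local x)
  ; adjacent    = λ x → IsDSRGAt.adjacent (local x)
  ; nonadjacent = λ x → IsDSRGAt.nonadjacent (local x)
  }
  where
  open IsLoop isLoop
    using (isQuasigroup; identityˡ; identityʳ;
           leftDividesˡ; leftDividesʳ; rightDividesˡ; rightDividesʳ)

  N : ℕ
  N = 2 + k

  left right : Fin N ↔ Fin N
  left  = mk↔ₛ′ (c ∙_) (c \\_) (leftDividesˡ c) (leftDividesʳ c)
  right = mk↔ₛ′ (_∙ c) (_// c) (rightDividesˡ c) (rightDividesʳ c)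

  -- A fixed point `a` would make both `c` and `e` solutions of `x ∙ a ≡ a`, whose solution is
  -- unique.
  left-free : ∀ a → c ∙ a ≢ a
  left-free a ca≡a = c≢e (trans (∙≡⇒≡// isQuasigroup ca≡a)
                            (sym (∙≡⇒≡// isQuasigroup (identityˡ a))))

  right-free : ∀ a → a ∙ c ≢ a
  right-free a ac≡a = c≢e (trans (∙≡⇒≡\\ isQuasigroup ac≡a)
                             (sym (∙≡⇒≡\\ isQuasigroup (identityʳ a))))

  local : ∀ x → IsDSRGAt (Γ₃-Arc _∙_ c) (4 * N ∸ 2) (2 * N + 2) (N + 2) 6 x
  local (x , y , 0F) = isDSRGAt-↔ (↔-id _) (Γ₃-arc _∙_)
    (layer₀ isQuasigroup left right left-free right-free x y)
  -- The exchange sends this vertex to `(y , x , 0F)` and interchanges the two multiplications by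
  -- `c`.
  local (x , y , 1F) = isDSRGAt-↔ (↔-id _) (Γ₃-arc _∙_)
    (isDSRGAt-↔ (exchange _∙_) (arc-exchange _∙_)
      (layer₀ isQuasigroup right left right-free left-free y x))
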